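{- Let $G=(V,E)$ be a connected graph on $n\ge 2$ vertices with maximum degree $\Delta$. (i) $\gamma^{DLD}(G)\le n-\beta_2(G)\le \left\lfloor n\left(1-\frac{1}{\Delta^2+1}\right)\right\rfloor$. (ii) If moreover $N(u)\not\subseteq N(v)$ for all distinct $u,v\in V$, then $\gamma^{DLD}(G)\le n-\beta(G)\le \left\lfloor n\left(1-\frac{1}{\Delta+1}\right)\right\rfloor$. (iii) If moreover $N(u)\not\subseteq N[v]$ for all distinct $u,v\in V$, then $\gamma^{SLD}(G)\le n-\beta(G)\le \left\lfloor n\left(1-\frac{1}{\Delta+1}\right)\right\rfloor$.
   Context: Graphs are finite, simple and undirected. For $u\in V$, $N(u)$ is the set of neighbours of $u$ and $N[u]=N(u)\cup\{u\}$; $d(u,v)$ is the distance. A code is a non-empty subset $C\subseteq V$; $I(C;u)=N[u]\cap C$. A code $C$ is self-locating-dominating if for every $u\in V\setminus C$ we have $I(C;u)\neq\emptyset$ and $\bigcap_{c\in I(C;u)}N[c]=\{u\}$. A code $C$ is solid-locating-dominating if $I(C;u)\ne\emptyset$ for every $u\in V\setminus C$ and $I(C;u)\not\subseteq I(C;v)$ for all distinct $u,v\in V\setminus C$. $\gamma^{SLD}(G)$, $\gamma^{DLD}(G)$ are the minimum sizes of such codes. $\beta(G)$ is the independence number of $G$. $\beta_2(G)$ is the maximum size of a set $S\subseteq V$ with $d(u,v)\ge 3$ for all distinct $u,v\in S$. -}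

module Defs where

open import Data.Bool.Properties using () renaming (_≟_ to _≟ᵇ_)
open import Data.Fin.Base using (Fin; fromℕ<)
open import Data.Fin.Properties using (all?; any?) renaming (_≟_ to _≟ᶠ_)
open import Data.Fin.Subset using (Subset; Nonempty; _∈_; _∉_; _⊈_; _∪_; _∩_; ⋂; ⁅_⁆; ∣_∣; ⊤; ⊥)
open import Data.Fin.Subset.Properties using (_∈?_; _⊆?_; nonempty?; anySubset?; ∣p∣≤n; ∈⊤; ∉⊥)
open import Data.List.Base using (map; filter; allFin)
open import Data.List.Extrema.Nat using (max)
open import Data.Nat.Base using (ℕ; zero; suc; NonZero; _∸_; _≤_; _<_; _≥_; >-nonZero⁻¹)
open import Data.Nat.Induction using (<-wellFounded)
open import Data.Nat.Properties using (_<?_; ≮⇒≥; <⇒≱; ∸-monoʳ-<; anyUpTo?)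
open import Data.Product.Base using (∃; _×_; _,_; proj₁; proj₂)
open import Data.Vec.Properties using (≡-dec)
open import Function.Base using (_∘_)
open import Induction.WellFounded using (Acc; acc)
open import Relation.Binary.PropositionalEquality using (_≡_; _≢_; refl)
open import Relation.Nullary.Decidable using (Dec; yes; no; map′; ¬?; _×-dec_; _→-dec_)
open import Relation.Nullary.Negation using (contradiction)
open import Relation.Unary using (Decidable)

-- Finite simple undirected graphs with vertex set Fin n, given by the open
-- neighbourhoods: u and v are adjacent iff v ∈ N u.
record Graph (n : ℕ) : Set where
  field
    N        : Fin n → Subset n
    N-sym    : ∀ {u v} → v ∈ N u → u ∈ N v
    N-irrefl : ∀ {u} → u ∉ N u

  N[_] : Fin n → Subset n
  N[ u ] = N u ∪ ⁅ u ⁆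

  -- The default value 0 only matters when n = 0.
  Δ : ℕ
  Δ = max 0 (map (∣_∣ ∘ N) (allFin n))

  data Walk : Fin n → Fin n → ℕ → Set where
    []  : ∀ {u} → Walk u u 0
    _∷_ : ∀ {u v w k} → v ∈ N u → Walk v w k → Walk u w (suc k)

  Connected : Set
  Connected = ∀ u v → ∃ λ k → Walk u v k

  IsDistance : Fin n → Fin n → ℕ → Set
  IsDistance u v d = Walk u v d × (∀ {k} → Walk u v k → d ≤ k)

  -- Vertices in different components are at distance ∞, so at distance ≥ m.
  Distance≥ : ℕ → Fin n → Fin n → Set
  Distance≥ m u v = ∀ {d} → IsDistance u v d → d ≥ m

  I : Subset n → Fin n → Subset n
  I C u = N[ u ] ∩ C

⋂[_]_ : ∀ {n} → Subset n → (Fin n → Subset n) → Subset n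
⋂[ A ] F = ⋂ (map F (filter (_∈? A) (allFin _)))

module _ {n : ℕ} (G : Graph n) where
  open Graph G

  SelfLocatingDominating : Subset n → Set
  SelfLocatingDominating C =
    Nonempty C ×
    (∀ u → u ∉ C → Nonempty (I C u) × ⋂[ I C u ] N[_] ≡ ⁅ u ⁆)

  SolidLocatingDominating : Subset n → Set
  SolidLocatingDominating C =
    Nonempty C ×
    (∀ u → u ∉ C → Nonempty (I C u)) ×
    (∀ u v → u ∉ C → v ∉ C → u ≢ v → I C u ⊈ I C v)

  Independent : Subset n → Set
  Independent S = ∀ u v → u ∈ S → v ∈ S → v ∉ N u

  -- Vertices pairwise at distance at least 3.
  TwoPacking : Subset n → Set
  TwoPacking S = ∀ u v → u ∈ S → v ∈ S → u ≢ v → Distance≥ 3 u v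

IsMinimumSize : ∀ {n} → (Subset n → Set) → ℕ → Set
IsMinimumSize P k = (∃ λ C → P C × ∣ C ∣ ≡ k) × (∀ C → P C → k ≤ ∣ C ∣)

IsMaximumSize : ∀ {n} → (Subset n → Set) → ℕ → Set
IsMaximumSize P k = (∃ λ C → P C × ∣ C ∣ ≡ k) × (∀ C → P C → ∣ C ∣ ≤ k)

module _ {n : ℕ} {P : Subset n → Set} (P? : Decidable P) where

  minimiser : (f : Subset n → ℕ) → ∃ P →
              ∃ λ C → P C × (∀ D → P D → f C ≤ f D)
  minimiser f (C₀ , p₀) = go C₀ p₀ (<-wellFounded (f C₀))
    where
    go : ∀ C → P C → Acc _<_ (f C) → ∃ λ C → P C × (∀ D → P D → f C ≤ f D)
    go C p (acc rs) with anySubset? (λ D → P? D ×-dec (f D <? f C))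
    ... | yes (D , q , D<C) = go D q (rs D<C)
    ... | no ∄D             = C , p , λ D q → ≮⇒≥ (λ D<C → ∄D (D , q , D<C))

  minimumSize : ∃ P → ∃ (IsMinimumSize P)
  minimumSize e with minimiser ∣_∣ e
  ... | C , p , least = ∣ C ∣ , (C , p , refl) , least

  maximumSize : ∃ P → ∃ (IsMaximumSize P)
  maximumSize e with minimiser (λ C → n ∸ ∣ C ∣) e
  ... | C , p , least =
    ∣ C ∣ , (C , p , refl) , λ D q → ≮⇒≥ (λ C<D →
      <⇒≱ (∸-monoʳ-< C<D (∣p∣≤n D)) (least D q))

module _ {n : ℕ} (G : Graph n) where
  open Graph G

  walk? : ∀ u v k → Dec (Walk u v k)
  walk? u v zero    = map′ (λ { refl → [] }) (λ { [] → refl }) (u ≟ᶠ v)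
  walk? u v (suc k) =
    map′ (λ { (w , a , p) → a ∷ p }) (λ { (a ∷ p) → _ , a , p })
         (any? (λ w → (w ∈? N u) ×-dec walk? w v k))

  isDistance? : ∀ u v d → Dec (IsDistance u v d)
  isDistance? u v d = walk? u v d ×-dec
    map′ (λ ∄k {k} p → ≮⇒≥ (λ k<d → ∄k (k , k<d , p)))
         (λ { h (k , k<d , p) → <⇒≱ k<d (h p) })
         (¬? (anyUpTo? (walk? u v) d))

  distance≥? : ∀ m u v → Dec (Distance≥ m u v)
  distance≥? m u v =
    map′ (λ ∄d {d} p → ≮⇒≥ (λ d<m → ∄d (d , d<m , p)))
         (λ { h (d , d<m , p) → <⇒≱ d<m (h p) })
         (¬? (anyUpTo? (isDistance? u v) m))

  selfLocatingDominating? : Decidable (SelfLocatingDominating G)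
  selfLocatingDominating? C =
    nonempty? C ×-dec
    all? (λ u → ¬? (u ∈? C) →-dec
      (nonempty? (I C u) ×-dec ≡-dec _≟ᵇ_ (⋂[ I C u ] N[_]) ⁅ u ⁆))

  solidLocatingDominating? : Decidable (SolidLocatingDominating G)
  solidLocatingDominating? C =
    nonempty? C ×-dec
    all? (λ u → ¬? (u ∈? C) →-dec nonempty? (I C u)) ×-dec
    all? (λ u → all? (λ v →
      ¬? (u ∈? C) →-dec ¬? (v ∈? C) →-dec ¬? (u ≟ᶠ v) →-dec
      ¬? (I C u ⊆? I C v)))

  independent? : Decidable (Independent G)
  independent? S = all? (λ u → all? (λ v →
    (u ∈? S) →-dec (v ∈? S) →-dec ¬? (v ∈? N u)))

  twoPacking? : Decidable (TwoPacking G)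
  twoPacking? S = all? (λ u → all? (λ v →
    (u ∈? S) →-dec (v ∈? S) →-dec ¬? (u ≟ᶠ v) →-dec distance≥? 3 u v))

  β-spec : ∃ (IsMaximumSize (Independent G))
  β-spec = maximumSize independent? (⊥ , λ _ _ u∈⊥ → contradiction u∈⊥ ∉⊥)

  β₂-spec : ∃ (IsMaximumSize (TwoPacking G))
  β₂-spec = maximumSize twoPacking? (⊥ , λ _ _ u∈⊥ → contradiction u∈⊥ ∉⊥)

  β β₂ : ℕ
  β  = proj₁ β-spec
  β₂ = proj₁ β₂-spec

-- Codes are non-empty, so γSLD and γDLD exist only for n ≥ 1; then the whole
-- vertex set is a code of either kind.
module _ {n : ℕ} .{{_ : NonZero n}} (G : Graph n) where

  ⊤-nonempty : Nonempty {n} ⊤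
  ⊤-nonempty = fromℕ< (>-nonZero⁻¹ n) , ∈⊤

  γSLD-spec : ∃ (IsMinimumSize (SelfLocatingDominating G))
  γSLD-spec = minimumSize (selfLocatingDominating? G)
    (⊤ , ⊤-nonempty , λ _ u∉⊤ → contradiction ∈⊤ u∉⊤)

  γDLD-spec : ∃ (IsMinimumSize (SolidLocatingDominating G))
  γDLD-spec = minimumSize (solidLocatingDominating? G)
    (⊤ , ⊤-nonempty , (λ _ u∉⊤ → contradiction ∈⊤ u∉⊤)
                    , (λ _ _ u∉⊤ → contradiction ∈⊤ u∉⊤))

  γSLD γDLD : ℕ
  γSLD = proj₁ γSLD-spec
  γDLD = proj₁ γDLD-spec

{-# OPTIONS --safe #-}

-- The complement of an independent set S is a dominating set, and I(V ∖ S; u)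
-- is N(u) for every u ∈ S, so the code conditions become conditions on open
-- neighbourhoods.  A set of vertices pairwise at distance at least 3 is
-- independent, and its members have disjoint nonempty neighbourhoods.
-- For the second inequalities, a maximum independent set (resp. 2-packing)
-- cannot be enlarged, so the balls of radius 1 (resp. 2) around its members
-- cover the graph; such a ball has at most 1 + Δ (resp. 1 + Δ²) vertices.
module Submission where

open import Defs
open import Data.Fin.Base using (Fin)
open import Data.Fin.Subset using (_⊈_)
open import Data.Integer.Base as ℤ using (+_)
open import Data.Nat.Base as ℕ using (ℕ; NonZero; _^_)
open import Data.Product.Base using (_×_)
open import Data.Rational.Base as ℚ using (1ℚ; floor)
open import Relation.Binary.PropositionalEquality using (_≢_)

open import Data.Empty using (⊥-elim)
open import Data.Fin.Base using (zero; suc)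
open import Data.Fin.Properties using () renaming (_≟_ to _≟ᶠ_)
open import Data.Fin.Subset
  using (Subset; Nonempty; inside; outside; _∈_; _∉_; _⊆_; _∪_; _-_; ∁; ⋂; ⁅_⁆; ∣_∣; ⊤; ⊥)
open import Data.Fin.Subset.Properties
open import Data.Integer.DivMod using (div-pos-is-/ℕ; n<s[n/ℕd]*d)
import Data.Integer.Properties as ℤ
open import Data.Integer.Tactic.RingSolver using (solve-∀)
open import Data.List.Base using (List; []; _∷_; map; allFin)
open import Data.List.Extrema.Nat using (xs≤max)
open import Data.List.Membership.Propositional.Properties using (∈-allFin; ∈-map⁺; ∈-filter⁺)
open import Data.List.Relation.Unary.All as All using (All; []; _∷_)
import Data.List.Relation.Unary.All.Properties as All
open import Data.Nat.Base using (suc; _+_; _*_; _≤_; _<_; z≤n; s≤s; z<s)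
open import Data.Nat.Induction using (<-rec)
import Data.Nat.Properties as ℕ
open import Data.Product.Base using (∃; _,_; proj₁; proj₂)
import Data.Rational.Properties as ℚ
open import Data.Rational.Unnormalised.Base as ℚᵘ using (mkℚᵘ; *≤*)
import Data.Rational.Unnormalised.Properties as ℚᵘ
open import Data.Sum.Base using (inj₁; inj₂)
open import Data.Vec.Base using ([]; _∷_; here; there)
open import Function.Base using (_∘_)
open import Relation.Binary.PropositionalEquality using (_≡_; refl; sym; trans; cong; subst)
open import Relation.Nullary.Decidable using (yes; no; decidable-stable)
open import Relation.Nullary.Negation using (contradiction)

-- Finite sets

∃≢ : ∀ {n} → 2 ≤ n → (x : Fin n) → ∃ λ y → x ≢ y
∃≢ (s≤s (s≤s _)) zero    = suc zero , λ ()
∃≢ (s≤s (s≤s _)) (suc x) = zero , λ ()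

∣p∪q∣≤∣p∣+∣q∣ : ∀ {n} (p q : Subset n) → ∣ p ∪ q ∣ ≤ ∣ p ∣ + ∣ q ∣
∣p∪q∣≤∣p∣+∣q∣ []            []            = z≤n
∣p∪q∣≤∣p∣+∣q∣ (inside ∷ p)  (inside ∷ q)  =
  s≤s (ℕ.≤-trans (∣p∪q∣≤∣p∣+∣q∣ p q) (ℕ.+-monoʳ-≤ ∣ p ∣ (ℕ.n≤1+n ∣ q ∣)))
∣p∪q∣≤∣p∣+∣q∣ (inside ∷ p)  (outside ∷ q) = s≤s (∣p∪q∣≤∣p∣+∣q∣ p q)
∣p∪q∣≤∣p∣+∣q∣ (outside ∷ p) (inside ∷ q)  =
  ℕ.≤-trans (s≤s (∣p∪q∣≤∣p∣+∣q∣ p q)) (ℕ.≤-reflexive (sym (ℕ.+-suc ∣ p ∣ ∣ q ∣)))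
∣p∪q∣≤∣p∣+∣q∣ (outside ∷ p) (outside ∷ q) = ∣p∪q∣≤∣p∣+∣q∣ p q

-- Recursion on the index set lets the cardinality bound `∣⋃∣≤` follow the same induction.
⋃[_]_ : ∀ {m n} → Subset m → (Fin m → Subset n) → Subset n
⋃[ [] ]          F = ⊥
⋃[ inside ∷ A ]  F = F zero ∪ ⋃[ A ] (F ∘ suc)
⋃[ outside ∷ A ] F = ⋃[ A ] (F ∘ suc)

x∈⋃⁺ : ∀ {m n} {A : Subset m} {F : Fin m → Subset n} {a x} → a ∈ A → x ∈ F a → x ∈ ⋃[ A ] F
x∈⋃⁺ {A = inside ∷ A}  {a = zero}  a∈A x∈Fa = x∈p∪q⁺ (inj₁ x∈Fa)
x∈⋃⁺ {A = inside ∷ A}  {a = suc a} a∈A x∈Fa = x∈p∪q⁺ (inj₂ (x∈⋃⁺ (drop-there a∈A) x∈Fa))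
x∈⋃⁺ {A = outside ∷ A} {a = suc a} a∈A x∈Fa = x∈⋃⁺ (drop-there a∈A) x∈Fa

∣⋃∣≤ : ∀ {m n} (A : Subset m) {F : Fin m → Subset n} {k} →
       (∀ {a} → a ∈ A → ∣ F a ∣ ≤ k) → ∣ ⋃[ A ] F ∣ ≤ ∣ A ∣ * k
∣⋃∣≤ {n = n} []  bound = ℕ.≤-reflexive (∣⊥∣≡0 n)
∣⋃∣≤ (inside ∷ A) {F} bound =
  ℕ.≤-trans (∣p∪q∣≤∣p∣+∣q∣ (F zero) _)
            (ℕ.+-mono-≤ (bound here) (∣⋃∣≤ A (bound ∘ there)))
∣⋃∣≤ (outside ∷ A) bound = ∣⋃∣≤ A (bound ∘ there)

x∈⋂⁺ : ∀ {n x} {ps : List (Subset n)} → All (x ∈_) ps → x ∈ ⋂ ps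
x∈⋂⁺ []           = ∈⊤
x∈⋂⁺ (x∈p ∷ x∈ps) = x∈p∩q⁺ (x∈p , x∈⋂⁺ x∈ps)

x∈⋂⁻ : ∀ {n x} (ps : List (Subset n)) → x ∈ ⋂ ps → All (x ∈_) ps
x∈⋂⁻ []       _    = []
x∈⋂⁻ (p ∷ ps) x∈⋂ with x∈p , x∈⋂ps ← x∈p∩q⁻ p (⋂ ps) x∈⋂ = x∈p ∷ x∈⋂⁻ ps x∈⋂ps

module _ {n} (A : Subset n) (F : Fin n → Subset n) where

  x∈⋂[]⁺ : ∀ {x} → (∀ {a} → a ∈ A → x ∈ F a) → x ∈ ⋂[ A ] F
  x∈⋂[]⁺ x∈F = x∈⋂⁺ (All.map⁺ (All.map x∈F (All.all-filter (_∈? A) (allFin n))))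

  x∈⋂[]⁻ : ∀ {x} → x ∈ ⋂[ A ] F → ∀ {a} → a ∈ A → x ∈ F a
  x∈⋂[]⁻ x∈⋂ {a} a∈A =
    All.lookup (All.map⁻ (x∈⋂⁻ _ x∈⋂)) (∈-filter⁺ (_∈? A) (∈-allFin a) a∈A)

x∉p⇒∣p∣<∣p∪⁅x⁆∣ : ∀ {n x} {p : Subset n} → x ∉ p → ∣ p ∣ < ∣ p ∪ ⁅ x ⁆ ∣
x∉p⇒∣p∣<∣p∪⁅x⁆∣ {x = x} {p} x∉p =
  p⊂q⇒∣p∣<∣q∣ (p⊆p∪q ⁅ x ⁆ , x , x∈p∪q⁺ (inj₂ (x∈⁅x⁆ x)) , x∉p)

-- If some `v` were missed by every `F s` with `s ∈ S`, where `S` is of maximum size, then `extend`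
-- would make `S ∪ ⁅ v ⁆` a strictly larger set with `P`. So these sets, each of size at most `k`,
-- cover all `n` vertices.
maximumSize-cover : ∀ {n b k} {P : Subset n → Set} (F : Fin n → Subset n) →
                    (∀ v → v ∈ F v) → (∀ v → ∣ F v ∣ ≤ k) →
                    (∀ S v → P S → (∀ {s} → s ∈ S → v ∉ F s) → P (S ∪ ⁅ v ⁆)) →
                    IsMaximumSize P b → n ≤ b * k
maximumSize-cover {n} {k = k} F centre bound extend ((S , PS , refl) , max) = begin
  n              ≡⟨ ∣⊤∣≡n n ⟨
  ∣ ⊤ {n} ∣      ≤⟨ p⊆q⇒∣p∣≤∣q∣ {p = ⊤} (λ {v} _ → covered v) ⟩
  ∣ ⋃[ S ] F ∣   ≤⟨ ∣⋃∣≤ S (λ {s} _ → bound s) ⟩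
  ∣ S ∣ * k      ∎
  where
  open ℕ.≤-Reasoning
  covered : ∀ v → v ∈ ⋃[ S ] F
  covered v = decidable-stable (v ∈? _) λ v∉⋃ →
    ℕ.<⇒≱ (x∉p⇒∣p∣<∣p∪⁅x⁆∣ {p = S} (λ v∈S → v∉⋃ (x∈⋃⁺ v∈S (centre v))))
          (max _ (extend S v PS (λ s∈S v∈Fs → v∉⋃ (x∈⋃⁺ s∈S v∈Fs))))

-- Bounds of the form n (1 - 1 / k)

-- With `p = m / d`, the floor is the integer quotient `q`; if `q < i`, then
-- `m < (q + 1) d ≤ i d ≤ m`. The hypothesis is unnormalised so that it can be checked by
-- cross-multiplication.
i≤⌊p⌋ : ∀ i p → mkℚᵘ i 0 ℚᵘ.≤ ℚ.toℚᵘ p → i ℤ.≤ floor p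
i≤⌊p⌋ i p@record{} (*≤* i*d≤m*1) =
  subst (i ℤ.≤_) (sym (div-pos-is-/ℕ m d)) (ℤ.≮⇒≥ λ q<i →
    ℤ.<-irrefl refl (begin-strict
      m                           <⟨ n<s[n/ℕd]*d m d ⟩
      ℤ.suc (m ℤ./ℕ d) ℤ.* + d    ≤⟨ ℤ.*-monoʳ-≤-nonNeg (+ d) (ℤ.i<j⇒suc[i]≤j q<i) ⟩
      i ℤ.* + d                   ≤⟨ i*d≤m*1 ⟩
      m ℤ.* + 1                   ≡⟨ ℤ.*-identityʳ m ⟩
      m                           ∎))
  where
  open ℤ.≤-Reasoning
  m = ℚ.↥ p
  d = ℚ.↧ₙ p

-- After multiplying by `K = suc k`, the inequality without the floor reads `n K - b K ≤ n K - n`,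
-- which is `n ≤ b K`. The left side is an integer, so the floor may then be taken.
n-b≤⌊n[1-1/[1+k]]⌋ : ∀ n b k → n ≤ b * suc k →
                 + n ℤ.- + b ℤ.≤ floor ((+ n ℚ./ 1) ℚ.* (1ℚ ℚ.- + 1 ℚ./ suc k))
n-b≤⌊n[1-1/[1+k]]⌋ n b k n≤bk = i≤⌊p⌋ (+ n ℤ.- + b) _ (begin
  mkℚᵘ (+ n ℤ.- + b) 0                                    ≤⟨ *≤* crossMultiplied ⟩
  mkℚᵘ (+ n) 0 ℚᵘ.* (ℚᵘ.1ℚᵘ ℚᵘ.- mkℚᵘ (+ 1) k)             ≃⟨ toℚᵘ-rhs ⟨
  ℚ.toℚᵘ ((+ n ℚ./ 1) ℚ.* (1ℚ ℚ.- + 1 ℚ./ suc k))         ∎)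
  where
  open ℚᵘ.≤-Reasoning

  toℚᵘ-rhs : ℚ.toℚᵘ ((+ n ℚ./ 1) ℚ.* (1ℚ ℚ.- + 1 ℚ./ suc k)) ℚᵘ.≃
             mkℚᵘ (+ n) 0 ℚᵘ.* (ℚᵘ.1ℚᵘ ℚᵘ.- mkℚᵘ (+ 1) k)
  -- Normalised arithmetic agrees with the unnormalised one only up to `≃`, so the conversion is
  -- pushed inward one operation at a time.
  toℚᵘ-rhs =
    ℚᵘ.≃-trans (ℚ.toℚᵘ-homo-* (+ n ℚ./ 1) (1ℚ ℚ.- + 1 ℚ./ suc k))
      (ℚᵘ.*-cong (ℚ.toℚᵘ-fromℚᵘ (mkℚᵘ (+ n) 0))
        (ℚᵘ.≃-trans (ℚ.toℚᵘ-homo-+ 1ℚ (ℚ.- (+ 1 ℚ./ suc k)))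
          (ℚᵘ.+-congʳ ℚᵘ.1ℚᵘ
            (ℚᵘ.≃-trans (ℚ.toℚᵘ-homo‿- (+ 1 ℚ./ suc k))
              (ℚᵘ.-‿cong (ℚ.toℚᵘ-fromℚᵘ (mkℚᵘ (+ 1) k)))))))

  -- The factors `+ 1` in both expansions mirror the numerators and denominators that unnormalised
  -- arithmetic leaves unsimplified.
  lhs-expand : ∀ n b k → (n ℤ.- b) ℤ.* (+ 1 ℤ.* (+ 1 ℤ.* k)) ≡ n ℤ.* k ℤ.- b ℤ.* k
  lhs-expand = solve-∀

  rhs-expand : ∀ n k → (n ℤ.* (+ 1 ℤ.* k ℤ.+ (ℤ.- + 1) ℤ.* + 1)) ℤ.* + 1 ≡ n ℤ.* k ℤ.- n
  rhs-expand = solve-∀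

  crossMultiplied : (+ n ℤ.- + b) ℤ.* (+ 1 ℤ.* (+ 1 ℤ.* + suc k)) ℤ.≤
                    (+ n ℤ.* (+ 1 ℤ.* + suc k ℤ.+ (ℤ.- + 1) ℤ.* + 1)) ℤ.* + 1
  crossMultiplied = ℤ.≤-trans (ℤ.≤-reflexive (lhs-expand (+ n) (+ b) (+ suc k)))
    (ℤ.≤-trans (ℤ.+-monoʳ-≤ (+ n ℤ.* + suc k) (ℤ.neg-mono-≤
                 (subst (+ n ℤ.≤_) (ℤ.pos-* b (suc k)) (ℤ.+≤+ n≤bk))))
      (ℤ.≤-reflexive (sym (rhs-expand (+ n) (+ suc k)))))

minimumSize≤n-maximumSize : ∀ {n g b} {P Q : Subset n → Set} →
                            IsMinimumSize P g → IsMaximumSize Q b →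
                            (∀ S → Q S → P (∁ S)) → + g ℤ.≤ + n ℤ.- + b
minimumSize≤n-maximumSize {n} {g} (_ , least) ((S , QS , refl) , _) Q⇒P∁ = begin
  + g                ≤⟨ ℤ.+≤+ (least (∁ S) (Q⇒P∁ S QS)) ⟩
  + ∣ ∁ S ∣          ≡⟨ cong +_ (∣∁p∣≡n∸∣p∣ S) ⟩
  + (n ℕ.∸ ∣ S ∣)    ≡⟨ ℤ.⊖-≥ (∣p∣≤n S) ⟨
  n ℤ.⊖ ∣ S ∣        ≡⟨ ℤ.[+m]-[+n]≡m⊖n n ∣ S ∣ ⟨
  + n ℤ.- + ∣ S ∣    ∎
  where open ℤ.≤-Reasoning

-- Graphs

module _ {n : ℕ} (G : Graph n) where
  open Graph G

  v∈N[v] : ∀ v → v ∈ N[ v ]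
  v∈N[v] v = x∈p∪q⁺ (inj₂ (x∈⁅x⁆ v))

  N⊆N[] : ∀ {v} → N v ⊆ N[ v ]
  N⊆N[] w∈Nv = x∈p∪q⁺ (inj₁ w∈Nv)

  N[]-sym : ∀ {u v} → v ∈ N[ u ] → u ∈ N[ v ]
  N[]-sym {u} v∈N[u] with x∈p∪q⁻ (N u) ⁅ u ⁆ v∈N[u]
  ... | inj₁ v∈Nu  = N⊆N[] (N-sym v∈Nu)
  ... | inj₂ v∈⁅u⁆ with refl ← x∈⁅y⁆⇒x≡y u v∈⁅u⁆ = v∈N[v] u

  N[]∧≢⇒N : ∀ {u v} → v ∈ N[ u ] → v ≢ u → v ∈ N u
  N[]∧≢⇒N {u} v∈N[u] v≢u with x∈p∪q⁻ (N u) ⁅ u ⁆ v∈N[u]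
  ... | inj₁ v∈Nu  = v∈Nu
  ... | inj₂ v∈⁅u⁆ = contradiction (x∈⁅y⁆⇒x≡y u v∈⁅u⁆) v≢u

  N⇒≢ : ∀ {u v} → v ∈ N u → u ≢ v
  N⇒≢ v∈Nu refl = N-irrefl v∈Nu

  ∣N∣≤Δ : ∀ v → ∣ N v ∣ ≤ Δ
  ∣N∣≤Δ v = All.lookup (xs≤max 0 (map (∣_∣ ∘ N) (allFin n))) (∈-map⁺ (∣_∣ ∘ N) (∈-allFin v))

  ∣N[]∣≤1+Δ : ∀ v → ∣ N[ v ] ∣ ≤ 1 + Δ
  ∣N[]∣≤1+Δ v = begin
    ∣ N[ v ] ∣             ≤⟨ ∣p∪q∣≤∣p∣+∣q∣ (N v) ⁅ v ⁆ ⟩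
    ∣ N v ∣ + ∣ ⁅ v ⁆ ∣    ≤⟨ ℕ.+-mono-≤ (∣N∣≤Δ v) (ℕ.≤-reflexive (∣⁅x⁆∣≡1 v)) ⟩
    Δ + 1                  ≡⟨ ℕ.+-comm Δ 1 ⟩
    1 + Δ                  ∎
    where open ℕ.≤-Reasoning

  -- Walks and distances

  snoc : ∀ {u v w k} → Walk u v k → w ∈ N v → Walk u w (suc k)
  snoc []      w∈N = w∈N ∷ []
  snoc (a ∷ p) w∈N = a ∷ snoc p w∈N

  reverse : ∀ {u v k} → Walk u v k → Walk v u k
  reverse []      = []
  reverse (a ∷ p) = snoc (reverse p) (N-sym a)

  shortest : ∀ {u v} k → Walk u v k → ∃ λ d → IsDistance u v d × d ≤ k
  shortest {u} {v} = <-rec (λ k → Walk u v k → ∃ λ d → IsDistance u v d × d ≤ k) step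
    where
    step : ∀ k → (∀ {j} → j < k → Walk u v j → ∃ λ d → IsDistance u v d × d ≤ j) →
           Walk u v k → ∃ λ d → IsDistance u v d × d ≤ k
    step k rec p with ℕ.anyUpTo? (walk? G u v) k
    ... | no ∄j = k , (p , λ {j} q → ℕ.≮⇒≥ λ j<k → ∄j (j , j<k , q)) , ℕ.≤-refl
    ... | yes (j , j<k , q) with d , isDist , d≤j ← rec j<k q =
      d , isDist , ℕ.≤-trans d≤j (ℕ.<⇒≤ j<k)

  -- `Distance≥` speaks only of exact distances; passing to a shortest walk carries the bound over
  -- to every walk.
  Distance≥⇒walk≥ : ∀ {m u v k} → Distance≥ m u v → Walk u v k → m ≤ k
  Distance≥⇒walk≥ {k = k} far p with d , isDist , d≤k ← shortest k p =
    ℕ.≤-trans (far isDist) d≤k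

  -- The ball of radius 2.  Deleting v from each N[ w ] leaves at most Δ vertices
  -- per neighbour w, which gives the size 1 + Δ · Δ.
  B₂ : Fin n → Subset n
  B₂ v = ⁅ v ⁆ ∪ (⋃[ N v ] λ w → N[ w ] - v)

  shortWalk⇒B₂ : ∀ {u v k} → Walk u v k → k < 3 → v ∈ B₂ u
  shortWalk⇒B₂ {u} [] _ = x∈p∪q⁺ (inj₁ (x∈⁅x⁆ u))
  shortWalk⇒B₂ {v = v} (a ∷ []) _ =
    x∈p∪q⁺ (inj₂ (x∈⋃⁺ a (x∈p∧x≢y⇒x∈p-y (v∈N[v] v) (N⇒≢ a ∘ sym))))
  -- A walk of length two may return to its start, which the deletion removes from the union; the
  -- singleton in `B₂` covers that case.
  shortWalk⇒B₂ {u} {v} (a ∷ b ∷ []) _ with v ≟ᶠ u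
  ... | yes refl = x∈p∪q⁺ (inj₁ (x∈⁅x⁆ u))
  ... | no v≢u   = x∈p∪q⁺ (inj₂ (x∈⋃⁺ a (x∈p∧x≢y⇒x∈p-y (N⊆N[] b) v≢u)))
  shortWalk⇒B₂ (_ ∷ _ ∷ _ ∷ _) (s≤s (s≤s (s≤s ())))

  ∣B₂∣≤1+Δ² : ∀ v → ∣ B₂ v ∣ ≤ 1 + Δ ^ 2
  ∣B₂∣≤1+Δ² v = begin
    ∣ B₂ v ∣                                          ≤⟨ ∣p∪q∣≤∣p∣+∣q∣ ⁅ v ⁆ _ ⟩
    ∣ ⁅ v ⁆ ∣ + ∣ (⋃[ N v ] λ w → N[ w ] - v) ∣       ≤⟨ ℕ.+-mono-≤ (ℕ.≤-reflexive (∣⁅x⁆∣≡1 v))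
                                                                    (∣⋃∣≤ (N v) ∣N[w]-v∣≤Δ) ⟩
    1 + ∣ N v ∣ * Δ                                   ≤⟨ s≤s (ℕ.*-monoˡ-≤ Δ (∣N∣≤Δ v)) ⟩
    1 + Δ * Δ                                         ≡⟨ cong (λ x → 1 + Δ * x) (ℕ.*-identityʳ Δ) ⟨
    1 + Δ ^ 2                                         ∎
    where
    open ℕ.≤-Reasoning
    ∣N[w]-v∣≤Δ : ∀ {w} → w ∈ N v → ∣ N[ w ] - v ∣ ≤ Δ
    ∣N[w]-v∣≤Δ {w} w∈Nv =
      ℕ.s≤s⁻¹ (ℕ.≤-trans (x∈p⇒∣p-x∣<∣p∣ (N⊆N[] (N-sym w∈Nv))) (∣N[]∣≤1+Δ w))

  -- Enlarging independent sets and 2-packings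

  independent-∪⁅v⁆ : ∀ S v → Independent G S → (∀ {s} → s ∈ S → v ∉ N[ s ]) →
                     Independent G (S ∪ ⁅ v ⁆)
  independent-∪⁅v⁆ S v ind far x y x∈ y∈ with x∈p∪q⁻ S ⁅ v ⁆ x∈ | x∈p∪q⁻ S ⁅ v ⁆ y∈
  ... | inj₁ x∈S | inj₁ y∈S = ind x y x∈S y∈S
  ... | inj₁ x∈S | inj₂ y∈v with refl ← x∈⁅y⁆⇒x≡y v y∈v = far x∈S ∘ N⊆N[]
  ... | inj₂ x∈v | inj₁ y∈S with refl ← x∈⁅y⁆⇒x≡y v x∈v = far y∈S ∘ N⊆N[] ∘ N-sym
  ... | inj₂ x∈v | inj₂ y∈v with refl ← x∈⁅y⁆⇒x≡y v x∈v | refl ← x∈⁅y⁆⇒x≡y v y∈v = N-irrefl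

  -- A walk of length below 3 between some `s ∈ S` and `v` would put `v` into `B₂ s`; walks that
  -- start at `v` are reversed first.
  twoPacking-∪⁅v⁆ : ∀ S v → TwoPacking G S → (∀ {s} → s ∈ S → v ∉ B₂ s) →
                    TwoPacking G (S ∪ ⁅ v ⁆)
  twoPacking-∪⁅v⁆ S v pack far x y x∈ y∈ x≢y with x∈p∪q⁻ S ⁅ v ⁆ x∈ | x∈p∪q⁻ S ⁅ v ⁆ y∈
  ... | inj₁ x∈S | inj₁ y∈S = pack x y x∈S y∈S x≢y
  ... | inj₁ x∈S | inj₂ y∈v with refl ← x∈⁅y⁆⇒x≡y v y∈v =
    λ (p , _) → ℕ.≮⇒≥ (far x∈S ∘ shortWalk⇒B₂ p)
  ... | inj₂ x∈v | inj₁ y∈S with refl ← x∈⁅y⁆⇒x≡y v x∈v =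
    λ (p , _) → ℕ.≮⇒≥ (far y∈S ∘ shortWalk⇒B₂ (reverse p))
  ... | inj₂ x∈v | inj₂ y∈v =
    contradiction (trans (x∈⁅y⁆⇒x≡y v x∈v) (sym (x∈⁅y⁆⇒x≡y v y∈v))) x≢y

  n≤β*[1+Δ] : n ≤ β G * (1 + Δ)
  n≤β*[1+Δ] = maximumSize-cover N[_] v∈N[v] ∣N[]∣≤1+Δ independent-∪⁅v⁆ (proj₂ (β-spec G))

  n≤β₂*[1+Δ²] : n ≤ β₂ G * (1 + Δ ^ 2)
  n≤β₂*[1+Δ²] = maximumSize-cover B₂ (λ v → shortWalk⇒B₂ [] z<s) ∣B₂∣≤1+Δ² twoPacking-∪⁅v⁆
                                  (proj₂ (β₂-spec G))

  -- Neighbourhoods of vertices in a 2-packing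

  twoPacking⇒independent : ∀ {S} → TwoPacking G S → Independent G S
  twoPacking⇒independent pack u v u∈S v∈S v∈Nu
    with s≤s () ← Distance≥⇒walk≥ (pack u v u∈S v∈S (N⇒≢ v∈Nu)) (v∈Nu ∷ [])

  -- A common neighbour `w` would give the walk `u`, `w`, `v` of length 2.
  twoPacking⇒disjoint : ∀ {S u v w} → TwoPacking G S → u ∈ S → v ∈ S → u ≢ v →
                        w ∈ N u → w ∉ N v
  twoPacking⇒disjoint pack u∈S v∈S u≢v w∈Nu w∈Nv
    with s≤s (s≤s ()) ←
      Distance≥⇒walk≥ (pack _ _ u∈S v∈S u≢v) (w∈Nu ∷ N-sym w∈Nv ∷ [])

  -- The first edge of a walk to another vertex supplies the neighbour.
  connected⇒N-nonempty : 2 ≤ n → Connected → ∀ u → Nonempty (N u)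
  connected⇒N-nonempty 2≤n conn u with v , u≢v ← ∃≢ 2≤n u with conn u v
  ... | _ , []    = contradiction refl u≢v
  ... | _ , a ∷ _ = _ , a

  -- Complements of independent sets as codes

  I⊆N : ∀ {C u} → u ∉ C → I C u ⊆ N u
  I⊆N {C} {u} u∉C w∈I with w∈N[u] , w∈C ← x∈p∩q⁻ N[ u ] C w∈I =
    N[]∧≢⇒N w∈N[u] λ { refl → u∉C w∈C }

  module _ (N-nonempty : ∀ u → Nonempty (N u)) where

    twoPacking⇒N⊈N : ∀ {S u v} → TwoPacking G S → u ∈ S → v ∈ S → u ≢ v → N u ⊈ N v
    twoPacking⇒N⊈N {u = u} pack u∈S v∈S u≢v Nu⊆Nv with w , w∈Nu ← N-nonempty u =
      twoPacking⇒disjoint pack u∈S v∈S u≢v w∈Nu (Nu⊆Nv w∈Nu)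

    module _ {S : Subset n} (ind : Independent G S) where

      N⊆I-∁ : ∀ {u} → u ∈ S → N u ⊆ I (∁ S) u
      N⊆I-∁ u∈S w∈Nu =
        x∈p∩q⁺ (N⊆N[] w∈Nu , x∉p⇒x∈∁p λ w∈S → ind _ _ u∈S w∈S w∈Nu)

      I-∁-nonempty : ∀ u → u ∉ ∁ S → Nonempty (I (∁ S) u)
      I-∁-nonempty u u∉∁S with w , w∈Nu ← N-nonempty u = w , N⊆I-∁ (x∉∁p⇒x∈p u∉∁S) w∈Nu

      -- Either the given vertex lies in the complement, or it lies in `S` and a neighbour of it
      -- does.
      ∁-nonempty : Fin n → Nonempty (∁ S)
      ∁-nonempty u with u ∈? ∁ S
      ... | yes u∈∁S = u , u∈∁S
      ... | no  u∉∁S with w , w∈I ← I-∁-nonempty u u∉∁S =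
        w , proj₂ (x∈p∩q⁻ N[ u ] (∁ S) w∈I)

      -- An inclusion of `I`-sets would yield `N u ⊆ I u ⊆ I v ⊆ N v`. The hypothesis is restricted
      -- to members of `S`, so that both 2-packings and graphs without nested open neighbourhoods
      -- satisfy it.
      ∁-solidLocatingDominating : Fin n → (∀ {u v} → u ∈ S → v ∈ S → u ≢ v → N u ⊈ N v) →
                                  SolidLocatingDominating G (∁ S)
      ∁-solidLocatingDominating x N⊈N =
        ∁-nonempty x , I-∁-nonempty , λ u v u∉∁S v∉∁S u≢v Iu⊆Iv →
          N⊈N (x∉∁p⇒x∈p u∉∁S) (x∉∁p⇒x∈p v∉∁S) u≢v
            (λ w∈Nu → I⊆N v∉∁S (Iu⊆Iv (N⊆I-∁ (x∉∁p⇒x∈p u∉∁S) w∈Nu)))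

      -- A vertex `v` in the intersection lies in `N[ w ]` for every `w ∈ N u`; by symmetry
      -- `N u ⊆ N[ v ]`, which forces `v = u`.
      ∁-selfLocatingDominating : Fin n → (∀ u v → u ≢ v → N u ⊈ N[ v ]) →
                                 SelfLocatingDominating G (∁ S)
      ∁-selfLocatingDominating x N⊈N[] =
        ∁-nonempty x , λ u u∉∁S → I-∁-nonempty u u∉∁S , ⊆-antisym (⋂⊆⁅u⁆ u u∉∁S) (⁅u⁆⊆⋂ u)
        where
        ⋂⊆⁅u⁆ : ∀ u → u ∉ ∁ S → ⋂[ I (∁ S) u ] N[_] ⊆ ⁅ u ⁆
        ⋂⊆⁅u⁆ u u∉∁S {v} v∈⋂ with u ≟ᶠ v
        ... | yes refl = x∈⁅x⁆ u
        ... | no u≢v   = ⊥-elim (N⊈N[] u v u≢v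
          (λ w∈Nu → N[]-sym (x∈⋂[]⁻ _ N[_] v∈⋂ (N⊆I-∁ (x∉∁p⇒x∈p u∉∁S) w∈Nu))))

        ⁅u⁆⊆⋂ : ∀ u → ⁅ u ⁆ ⊆ ⋂[ I (∁ S) u ] N[_]
        ⁅u⁆⊆⋂ u v∈⁅u⁆ with refl ← x∈⁅y⁆⇒x≡y u v∈⁅u⁆ =
          x∈⋂[]⁺ _ N[_] λ w∈I → N[]-sym (proj₁ (x∈p∩q⁻ N[ u ] (∁ S) w∈I))

mainTheorem8 : (n : ℕ) .{{_ : NonZero n}} (G : Graph n) → let open Graph G in
    2 ℕ.≤ n → Connected →
    (+ γDLD G ℤ.≤ + n ℤ.- + β₂ G ×
    + n ℤ.- + β₂ G ℤ.≤ floor ((+ n ℚ./ 1) ℚ.* (1ℚ ℚ.- + 1 ℚ./ (1 ℕ.+ Δ ^ 2)))) ×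
    ((∀ u v → u ≢ v → N u ⊈ N v) →
    + γDLD G ℤ.≤ + n ℤ.- + β G ×
    + n ℤ.- + β G ℤ.≤ floor ((+ n ℚ./ 1) ℚ.* (1ℚ ℚ.- + 1 ℚ./ (1 ℕ.+ Δ)))) ×
    ((∀ u v → u ≢ v → N u ⊈ N[ v ]) →
    + γSLD G ℤ.≤ + n ℤ.- + β G ×
    + n ℤ.- + β G ℤ.≤ floor ((+ n ℚ./ 1) ℚ.* (1ℚ ℚ.- + 1 ℚ./ (1 ℕ.+ Δ))))
mainTheorem8 n G 2≤n conn =
  ( minimumSize≤n-maximumSize γDLD-min (proj₂ (β₂-spec G)) (λ S pack →
      ∁-solidLocatingDominating G N≠∅ (twoPacking⇒independent G pack) x
        (twoPacking⇒N⊈N G N≠∅ pack))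
  , n-b≤⌊n[1-1/[1+k]]⌋ n (β₂ G) (Δ ^ 2) (n≤β₂*[1+Δ²] G) ) ,
  (λ N⊈N →
    minimumSize≤n-maximumSize γDLD-min β-max (λ S ind →
      ∁-solidLocatingDominating G N≠∅ ind x (λ _ _ → N⊈N _ _))
  , n-b≤⌊n[1-1/[1+k]]⌋ n (β G) Δ (n≤β*[1+Δ] G)) ,
  (λ N⊈N[] →
    minimumSize≤n-maximumSize (proj₂ (γSLD-spec G)) β-max (λ S ind →
      ∁-selfLocatingDominating G N≠∅ ind x N⊈N[])
  , n-b≤⌊n[1-1/[1+k]]⌋ n (β G) Δ (n≤β*[1+Δ] G))
  where
  open Graph G
  -- An arbitrary vertex, from which the non-emptiness of the codes is derived.
  x = proj₁ (⊤-nonempty G)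
  N≠∅ = connected⇒N-nonempty G 2≤n conn
  γDLD-min = proj₂ (γDLD-spec G)
  β-max = proj₂ (β-spec G)
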